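{- Let $G$ and $H$ be finite simple graphs with subsets $B_G\subseteq V(G)$ and $B_H\subseteq V(H)$. If $$\zeta_G(B_G)<\zeta_H(B_H),$$ then there is no surjective graph homomorphism $f:G\to H$ with $f(B_G)=B_H$.
   Context: A graph homomorphism $f:G\to H$ is a map $f:V(G)\to V(H)$ such that $uv\in E(G)$ implies $f(u)f(v)\in E(H)$; it is surjective if it maps onto all of $V(H)$. For a finite simple graph $G$ and a subset $B\subseteq V(G)$, the $B$-restricted clique polynomial is $C_B(G;x)=\sum_{i=0}^{\omega(G[B])} c_i(B)x^i$, where $c_i(B)$ is the number of subsets $K\subseteq B$ with $|K|=i$ that are cliques in $G$; the empty set counts as a clique, so $c_0(B)=1$. Let $Z_B(G)=\{x<0 : C_B(G;x)=0\}$ (real $x$). If $Z_B(G)\neq\emptyset$, define $\zeta_G(B)=\max Z_B(G)$, the largest negative root of $C_B(G;x)$; if $Z_B(G)=\emptyset$, set $\zeta_G(B)=-\infty$. -}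

module Defs where

open import Algebra.Bundles.Raw using (RawSemiring)
import Algebra.Definitions.RawSemiring as RawSemiringDefs
open import Data.Fin using (Fin; toℕ)
open import Data.Fin.Properties using (all?) renaming (_≟_ to _≟ᶠ_)
open import Data.Fin.Subset using (Subset; inside; outside; _∈_; ∣_∣)
open import Data.Fin.Subset.Properties using (_∈?_; _⊆?_)
open import Data.List using (List; []; _∷_; _++_; map; filter; foldr; length)
open import Data.Nat as ℕ using (ℕ; zero; suc)
import Data.Nat.Properties as ℕ
open import Data.Product using (∃; _×_; _,_)
open import Data.Rational as ℚ using (ℚ; 0ℚ; 1ℚ; ½; Positive; positive; nonNegative; 1/_)
import Data.Rational.Properties as ℚ
open import Data.Rational.Solver using (module +-*-Solver)
open import Data.Vec using ([]; _∷_)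
open import Function using (_⇔_)
open import Level using (0ℓ)
open import Relation.Binary using (Rel; Decidable; Symmetric; Irreflexive)
open import Relation.Binary.PropositionalEquality
  using (_≡_; _≢_; refl; sym; trans; cong; subst)
open import Relation.Nullary using (¬_; Dec)
open import Relation.Nullary.Decidable using (_×-dec_; _→-dec_; ¬?)
open import Relation.Nullary.Construct.Add.Infimum using (_₋; ⊥₋; [_])
import Relation.Binary.Construct.Add.Infimum.Strict as AddInfimum

------------------------------------------------------------------------
-- Real numbers: Cauchy sequences of rationals, with operations taken
-- termwise and equality _≈ʳ_ meaning that the difference tends to zero.

IsCauchy : (ℕ → ℚ) → Set
IsCauchy s = ∀ ε → 0ℚ ℚ.< ε →
  ∃ λ N → ∀ {m n} → N ℕ.≤ m → N ℕ.≤ n → ℚ.∣ s m ℚ.- s n ∣ ℚ.< ε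

record ℝ : Set where
  constructor mkℝ
  field
    seq    : ℕ → ℚ
    cauchy : IsCauchy seq

open ℝ public

infix 4 _≈ʳ_ _<ʳ_ _≤ʳ_

_≈ʳ_ : Rel ℝ 0ℓ
x ≈ʳ y = ∀ ε → 0ℚ ℚ.< ε →
  ∃ λ N → ∀ {n} → N ℕ.≤ n → ℚ.∣ seq x n ℚ.- seq y n ∣ ℚ.< ε

_<ʳ_ : Rel ℝ 0ℓ
x <ʳ y = ∃ λ ε → 0ℚ ℚ.< ε ×
  ∃ λ N → ∀ {n} → N ℕ.≤ n → seq x n ℚ.+ ε ℚ.≤ seq y n

_≤ʳ_ : Rel ℝ 0ℓ
x ≤ʳ y = ¬ (y <ʳ x)

private abstract

  half-pos : ∀ {ε} → 0ℚ ℚ.< ε → 0ℚ ℚ.< ½ ℚ.* ε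
  half-pos {ε} ε>0 = subst (ℚ._< ½ ℚ.* ε) (ℚ.*-zeroʳ ½) (ℚ.*-monoʳ-<-pos ½ ε>0)

  half+half : ∀ ε → ½ ℚ.* ε ℚ.+ ½ ℚ.* ε ≡ ε
  half+half ε = trans (sym (ℚ.*-distribʳ-+ ε ½ ½)) (ℚ.*-identityˡ ε)

  const-cauchy : ∀ q → IsCauchy (λ _ → q)
  const-cauchy q ε ε>0 =
    0 , λ _ _ → subst (λ r → ℚ.∣ r ∣ ℚ.< ε) (sym (ℚ.+-inverseʳ q)) ε>0

  +-cauchy : ∀ {s t} → IsCauchy s → IsCauchy t → IsCauchy (λ n → s n ℚ.+ t n)
  +-cauchy {s} {t} cs ct ε ε>0
    with M , p ← cs (½ ℚ.* ε) (half-pos ε>0)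
       | N , q ← ct (½ ℚ.* ε) (half-pos ε>0)
    = M ℕ.⊔ N , λ {m} {n} hm hn → begin-strict
      ℚ.∣ (s m ℚ.+ t m) ℚ.- (s n ℚ.+ t n) ∣
        ≡⟨ cong ℚ.∣_∣ (rearrange (s m) (t m) (s n) (t n)) ⟩
      ℚ.∣ (s m ℚ.- s n) ℚ.+ (t m ℚ.- t n) ∣
        ≤⟨ ℚ.∣p+q∣≤∣p∣+∣q∣ (s m ℚ.- s n) (t m ℚ.- t n) ⟩
      ℚ.∣ s m ℚ.- s n ∣ ℚ.+ ℚ.∣ t m ℚ.- t n ∣
        <⟨ ℚ.+-mono-< (p (ℕ.m⊔n≤o⇒m≤o M N hm) (ℕ.m⊔n≤o⇒m≤o M N hn))
                      (q (ℕ.m⊔n≤o⇒n≤o M N hm) (ℕ.m⊔n≤o⇒n≤o M N hn)) ⟩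
      ½ ℚ.* ε ℚ.+ ½ ℚ.* ε
        ≡⟨ half+half ε ⟩
      ε ∎
    where
    open ℚ.≤-Reasoning
    rearrange : ∀ a b c d → (a ℚ.+ b) ℚ.- (c ℚ.+ d) ≡ (a ℚ.- c) ℚ.+ (b ℚ.- d)
    rearrange = +-*-Solver.solve 4
      (λ a b c d → (a :+ b) :- (c :+ d) := (a :- c) :+ (b :- d)) refl
      where open +-*-Solver

  eventuallyBounded : ∀ {s} → IsCauchy s →
    ∃ λ M → Positive M × ∃ λ N → ∀ {n} → N ℕ.≤ n → ℚ.∣ s n ∣ ℚ.≤ M
  eventuallyBounded {s} cs with N , p ← cs 1ℚ (ℚ.positive⁻¹ 1ℚ)
    = 1ℚ ℚ.+ ℚ.∣ s N ∣
    , positive (ℚ.+-mono-<-≤ (ℚ.positive⁻¹ 1ℚ) (ℚ.0≤∣p∣ (s N)))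
    , N
    , λ {n} hn → begin
      ℚ.∣ s n ∣                         ≡⟨ cong ℚ.∣_∣ (split (s n) (s N)) ⟩
      ℚ.∣ (s n ℚ.- s N) ℚ.+ s N ∣       ≤⟨ ℚ.∣p+q∣≤∣p∣+∣q∣ (s n ℚ.- s N) (s N) ⟩
      ℚ.∣ s n ℚ.- s N ∣ ℚ.+ ℚ.∣ s N ∣   ≤⟨ ℚ.+-monoˡ-≤ ℚ.∣ s N ∣ (ℚ.<⇒≤ (p hn ℕ.≤-refl)) ⟩
      1ℚ ℚ.+ ℚ.∣ s N ∣                  ∎
    where
    open ℚ.≤-Reasoning
    split : ∀ a b → a ≡ (a ℚ.- b) ℚ.+ b
    split = +-*-Solver.solve 2 (λ a b → a := (a :- b) :+ b) refl
      where open +-*-Solver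

  shrink : ∀ M ε → Positive M → 0ℚ ℚ.< ε → ∃ λ δ → 0ℚ ℚ.< δ × M ℚ.* δ ≡ ε
  shrink M ε M>0 ε>0 = 1/M ℚ.* ε
    , ℚ.positive⁻¹ (1/M ℚ.* ε)
        {{ℚ.pos*pos⇒pos 1/M {{ℚ.1/pos⇒pos M {{M>0}}}} ε {{positive ε>0}}}}
    , trans (sym (ℚ.*-assoc M 1/M ε))
        (trans (cong (ℚ._* ε) (ℚ.*-inverseʳ M {{M≢0}})) (ℚ.*-identityˡ ε))
    where
    M≢0 : ℚ.NonZero M
    M≢0 = ℚ.pos⇒nonZero M {{M>0}}
    1/M : ℚ
    1/M = (1/ M) {{M≢0}}

  scale : ∀ M a b {δ ε} → Positive M → ℚ.∣ a ∣ ℚ.≤ M →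
    M ℚ.* δ ≡ ε → ℚ.∣ b ∣ ℚ.< δ → ℚ.∣ a ℚ.* b ∣ ℚ.< ε
  scale M a b {δ} {ε} M>0 ha eq hb = begin-strict
    ℚ.∣ a ℚ.* b ∣          ≡⟨ ℚ.∣p*q∣≡∣p∣*∣q∣ a b ⟩
    ℚ.∣ a ∣ ℚ.* ℚ.∣ b ∣    ≤⟨ ℚ.*-monoʳ-≤-nonNeg ℚ.∣ b ∣ {{nonNegative (ℚ.0≤∣p∣ b)}} ha ⟩
    M ℚ.* ℚ.∣ b ∣          <⟨ ℚ.*-monoʳ-<-pos M {{M>0}} hb ⟩
    M ℚ.* δ                ≡⟨ eq ⟩
    ε                      ∎
    where open ℚ.≤-Reasoning

  product-estimate : ∀ {a b c d S T δ η ε} → Positive S → Positive T →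
    ℚ.∣ a ∣ ℚ.≤ S → ℚ.∣ d ∣ ℚ.≤ T →
    T ℚ.* δ ≡ ½ ℚ.* ε → S ℚ.* η ≡ ½ ℚ.* ε →
    ℚ.∣ a ℚ.- c ∣ ℚ.< δ → ℚ.∣ b ℚ.- d ∣ ℚ.< η →
    ℚ.∣ a ℚ.* b ℚ.- c ℚ.* d ∣ ℚ.< ε
  product-estimate {a} {b} {c} {d} {S} {T} {ε = ε} S>0 T>0 ha hd eqδ eqη hac hbd =
    begin-strict
      ℚ.∣ a ℚ.* b ℚ.- c ℚ.* d ∣
        ≡⟨ cong ℚ.∣_∣ (rearrange a b c d) ⟩
      ℚ.∣ a ℚ.* (b ℚ.- d) ℚ.+ d ℚ.* (a ℚ.- c) ∣
        ≤⟨ ℚ.∣p+q∣≤∣p∣+∣q∣ (a ℚ.* (b ℚ.- d)) (d ℚ.* (a ℚ.- c)) ⟩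
      ℚ.∣ a ℚ.* (b ℚ.- d) ∣ ℚ.+ ℚ.∣ d ℚ.* (a ℚ.- c) ∣
        <⟨ ℚ.+-mono-< (scale S a (b ℚ.- d) S>0 ha eqη hbd)
                      (scale T d (a ℚ.- c) T>0 hd eqδ hac) ⟩
      ½ ℚ.* ε ℚ.+ ½ ℚ.* ε
        ≡⟨ half+half ε ⟩
      ε ∎
    where
    open ℚ.≤-Reasoning
    rearrange : ∀ a b c d →
      a ℚ.* b ℚ.- c ℚ.* d ≡ a ℚ.* (b ℚ.- d) ℚ.+ d ℚ.* (a ℚ.- c)
    rearrange = +-*-Solver.solve 4
      (λ a b c d → a :* b :- c :* d := a :* (b :- d) :+ d :* (a :- c)) refl
      where open +-*-Solver

  *-cauchy : ∀ {s t} → IsCauchy s → IsCauchy t → IsCauchy (λ n → s n ℚ.* t n)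
  *-cauchy {s} {t} cs ct ε ε>0 =
    let S , S>0 , A , bs = eventuallyBounded cs
        T , T>0 , B , bt = eventuallyBounded ct
        δ , δ>0 , eqδ = shrink T (½ ℚ.* ε) T>0 (half-pos ε>0)
        η , η>0 , eqη = shrink S (½ ℚ.* ε) S>0 (half-pos ε>0)
        C , p = cs δ δ>0
        D , q = ct η η>0
    in (A ℕ.⊔ B) ℕ.⊔ (C ℕ.⊔ D) , λ {m} {n} hm hn →
      let AB≤m = ℕ.m⊔n≤o⇒m≤o (A ℕ.⊔ B) (C ℕ.⊔ D) hm
          AB≤n = ℕ.m⊔n≤o⇒m≤o (A ℕ.⊔ B) (C ℕ.⊔ D) hn
          CD≤m = ℕ.m⊔n≤o⇒n≤o (A ℕ.⊔ B) (C ℕ.⊔ D) hm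
          CD≤n = ℕ.m⊔n≤o⇒n≤o (A ℕ.⊔ B) (C ℕ.⊔ D) hn
      in product-estimate {s m} {t m} {s n} {t n} S>0 T>0
           (bs (ℕ.m⊔n≤o⇒m≤o A B AB≤m)) (bt (ℕ.m⊔n≤o⇒n≤o A B AB≤n)) eqδ eqη
           (p (ℕ.m⊔n≤o⇒m≤o C D CD≤m) (ℕ.m⊔n≤o⇒m≤o C D CD≤n))
           (q (ℕ.m⊔n≤o⇒n≤o C D CD≤m) (ℕ.m⊔n≤o⇒n≤o C D CD≤n))

fromℚ : ℚ → ℝ
fromℚ q = mkℝ (λ _ → q) (const-cauchy q)

0ʳ 1ʳ : ℝ
0ʳ = fromℚ 0ℚ
1ʳ = fromℚ 1ℚ

infixl 6 _+ʳ_
infixl 7 _*ʳ_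

_+ʳ_ _*ʳ_ : ℝ → ℝ → ℝ
x +ʳ y = mkℝ (λ n → seq x n ℚ.+ seq y n)
              (+-cauchy {seq x} {seq y} (cauchy x) (cauchy y))
x *ʳ y = mkℝ (λ n → seq x n ℚ.* seq y n)
              (*-cauchy {seq x} {seq y} (cauchy x) (cauchy y))

ℝ-rawSemiring : RawSemiring 0ℓ 0ℓ
ℝ-rawSemiring = record
  { Carrier = ℝ
  ; _≈_     = _≈ʳ_
  ; _+_     = _+ʳ_
  ; _*_     = _*ʳ_
  ; 0#      = 0ʳ
  ; 1#      = 1ʳ
  }

open RawSemiringDefs ℝ-rawSemiring public
  using () renaming (_×_ to _·ʳ_; _^_ to _^ʳ_; sum to sumʳ)

-- ℝ with a least element ⊥₋, which plays the role of -∞.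
open AddInfimum _<ʳ_ public using () renaming (_<₋_ to _<₋∞_)

------------------------------------------------------------------------
-- Finite simple graphs and restricted clique polynomials

record Graph : Set₁ where
  infix 4 _~_ _~?_
  field
    order  : ℕ
    _~_    : Rel (Fin order) 0ℓ
    _~?_   : Decidable _~_
    sym~   : Symmetric _~_
    irrefl : Irreflexive _≡_ _~_

  Vertex : Set
  Vertex = Fin order

  IsClique : Subset order → Set
  IsClique K = ∀ u v → u ∈ K → v ∈ K → u ≢ v → u ~ v

  isClique? : ∀ K → Dec (IsClique K)
  isClique? K = all? λ u → all? λ v →
    (u ∈? K) →-dec ((v ∈? K) →-dec (¬? (u ≟ᶠ v) →-dec (u ~? v)))

allSubsets : ∀ n → List (Subset n)
allSubsets zero    = [] ∷ []
allSubsets (suc n) =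
  map (inside ∷_) (allSubsets n) ++ map (outside ∷_) (allSubsets n)

module _ (G : Graph) where
  open Graph G

  cliquesIn : Subset order → List (Subset order)
  cliquesIn B = filter (λ K → (K ⊆? B) ×-dec isClique? K) (allSubsets order)

  -- ω(G[B]); cliques of G[B] are the cliques of G contained in B.
  cliqueNumber : Subset order → ℕ
  cliqueNumber B = foldr ℕ._⊔_ 0 (map ∣_∣ (cliquesIn B))

  cliqueCount : Subset order → ℕ → ℕ
  cliqueCount B i = length (filter (λ K → ∣ K ∣ ℕ.≟ i) (cliquesIn B))

  cliquePoly : Subset order → ℝ → ℝ
  cliquePoly B x =
    sumʳ {suc (cliqueNumber B)} λ i → cliqueCount B (toℕ i) ·ʳ (x ^ʳ toℕ i)

  NegRoot : Subset order → ℝ → Set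
  NegRoot B x = x <ʳ 0ʳ × cliquePoly B x ≈ʳ 0ʳ

  -- IsZeta B z says z = ζ_G(B). A relation, because reals are only
  -- considered up to _≈ʳ_ and the two cases are not decided here.
  data IsZeta (B : Subset order) : ℝ ₋ → Set where
    largest : ∀ {x} → NegRoot B x → (∀ y → NegRoot B y → y ≤ʳ x) →
              IsZeta B [ x ]
    noRoot  : (∀ y → ¬ NegRoot B y) → IsZeta B ⊥₋

MapsOnto : ∀ {m n} → (Fin m → Fin n) → Subset m → Subset n → Set
MapsOnto f B B′ = ∀ w → w ∈ B′ ⇔ (∃ λ v → v ∈ B × f v ≡ w)

{-# OPTIONS --safe #-}
module Submission where

-- For x ≤ 0 let W x S be the clique polynomial of G[S]. Removing a vertex v gives
-- W x S = W x (S − v) + x W x (S ∩ N v). Call x good if W x S > 0 for all S ⊆ B-G;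
-- at good points W x is antitone in S.
--
-- Let σ be a section of f with σ(B-H) ⊆ B-G. Adjacency of σ u and σ w implies
-- adjacency of u and w, so on subsets T of B-H the functions F T = W_G x (σ T) and
-- Q T = W_H x T satisfy the recurrence with N_F ⊆ N_Q. Induction on T shows that
-- Q T / F T is increasing in T at good x, whence W_G x B-G ≤ W_G x (σ B-H) ≤ W_H x B-H.
--
-- Now let x be a negative root of the clique polynomial of H. If x is a limit of good
-- rationals, the inequality makes x a root for G. Otherwise bisect between 0, which is
-- good, and a bad rational b close to x. The good end points h of the intervals converge
-- to a root y ≥ b for G: a nearby bad end point has some W S ≤ 0, and
-- 0 < W h B-G ≤ W h S. Either way G has a root above x − ε.

open import Defs
open import Algebra.Bundles using (CommutativeRing)
import Algebra.Definitions.RawSemiring as RawSemiringDefs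
import Algebra.Properties.Semiring.Sum as SemiringSum
open import Data.Bool using (true; false; if_then_else_)
open import Data.Fin as Fin using (Fin; zero; suc; toℕ)
import Data.Fin.Properties as Fin
open import Data.Fin.Subset using (Subset; inside; outside; _∈_; _∉_; _⊆_; _⊂_; _∩_; ⊥)
  renaming (∣_∣ to size; _-_ to _∖_)
open import Data.Fin.Subset.Induction using (⊂-wellFounded)
open import Data.Fin.Subset.Properties
  using (_∈?_; _⊆?_; anySubset?; drop-there; ∉⊥; ∣⊥∣≡0; ⊆-refl; ⊆-antisym; ⊆-min; p∩q⊆p; p∩q⊆q; x∈p∩q⁺;
         p─q⊆p; x∈p∧x≢y⇒x∈p-y; x∈p⇒p-x⊂p)
open import Data.Integer as ℤ using (-[1+_])
import Data.Integer.Properties as ℤ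
open import Data.List using (List; []; _∷_; _++_; map; filter; foldr; length)
open import Data.List.Relation.Unary.All as All using (All; []; _∷_)
open import Data.Nat as ℕ using (ℕ; zero; suc)
import Data.Nat.Properties as ℕ
open import Data.Product using (∃; _×_; _,_; proj₁; proj₂)
open import Data.Rational as ℚ
  using (ℚ; 0ℚ; 1ℚ; ½; _+_; _*_; _-_; -_; _≤_; _<_; ∣_∣; 1/_; mkℚ; positive; nonNegative)
import Data.Rational.Properties as ℚ
open import Data.Rational.Solver using (module +-*-Solver)
open import Data.Rational.Unnormalised as ℚᵘ using (mkℚᵘ)
import Data.Rational.Unnormalised.Properties as ℚᵘ
open import Data.Sum using (_⊎_; inj₁; inj₂)
open import Data.Vec using ([]; _∷_; tabulate; here; there; _[_]≔_)
import Data.Vec.Properties as Vec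
open import Function using (_∘_; Equivalence)
open import Function.Definitions using (Surjective)
open import Induction.WellFounded using (Acc; acc)
import Relation.Binary.Construct.Add.Infimum.Strict as AddInfimum
open import Relation.Binary.Morphism.Structures using (IsRelHomomorphism)
open import Relation.Binary.PropositionalEquality
  using (_≡_; _≢_; refl; sym; trans; cong; cong₂; subst; subst₂; module ≡-Reasoning)
open import Relation.Nullary using (¬_; Dec; yes; no; does; contradiction)
open import Relation.Nullary.Construct.Add.Infimum using (_₋; ⊥₋; [_])
open import Relation.Nullary.Decidable using (_×-dec_; ¬?; decidable-stable; dec-true; dec-false)
open import Relation.Unary using (Pred; Decidable)

open +-*-Solver using (solve; _:+_; _:*_; _:-_; :-_; _:=_; con)
open RawSemiringDefs ℚ.+-*-rawSemiring using (_^_; sum) renaming (_×_ to _·_)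
open SemiringSum (CommutativeRing.semiring ℚ.+-*-commutativeRing)
  using (sum-cong-≗; ∑-distrib-+; sum-replicate-zero)

-- Rational arithmetic

≤-by-difference : ∀ {p q d} → q ≡ p + d → 0ℚ ≤ d → p ≤ q
≤-by-difference {p} {q} {d} eq d≥0 = begin
  p       ≡⟨ ℚ.+-identityʳ p ⟨
  p + 0ℚ  ≤⟨ ℚ.+-monoʳ-≤ p d≥0 ⟩
  p + d   ≡⟨ eq ⟨
  q       ∎
  where open ℚ.≤-Reasoning

0≤difference : ∀ {p q} → p ≤ q → 0ℚ ≤ q - p
0≤difference {p} {q} p≤q = subst (_≤ q - p) (ℚ.+-inverseʳ p) (ℚ.+-monoˡ-≤ (- p) p≤q)

*-monoʳ-≤ : ∀ {r p q} → 0ℚ ≤ r → p ≤ q → r * p ≤ r * q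
*-monoʳ-≤ {r} r≥0 = ℚ.*-monoˡ-≤-nonNeg r {{nonNegative r≥0}}

*-monoˡ-≤ : ∀ {r p q} → 0ℚ ≤ r → p ≤ q → p * r ≤ q * r
*-monoˡ-≤ {r} r≥0 = ℚ.*-monoʳ-≤-nonNeg r {{nonNegative r≥0}}

0≤* : ∀ {p q} → 0ℚ ≤ p → 0ℚ ≤ q → 0ℚ ≤ p * q
0≤* {p} {q} p≥0 q≥0 = subst (_≤ p * q) (ℚ.*-zeroʳ p) (*-monoʳ-≤ p≥0 q≥0)

0<* : ∀ {p q} → 0ℚ < p → 0ℚ < q → 0ℚ < p * q
0<* {p} {q} p>0 q>0 =
  subst (_< p * q) (ℚ.*-zeroʳ p) (ℚ.*-monoʳ-<-pos p {{positive p>0}} q>0)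

0≤+ : ∀ {p q} → 0ℚ ≤ p → 0ℚ ≤ q → 0ℚ ≤ p + q
0≤+ = ℚ.+-mono-≤

0≤-neg : ∀ {p} → p ≤ 0ℚ → 0ℚ ≤ - p
0≤-neg = ℚ.neg-antimono-≤

0≤1 : 0ℚ ≤ 1ℚ
0≤1 = ℚ.<⇒≤ (ℚ.positive⁻¹ 1ℚ)

0≤½ : 0ℚ ≤ ½
0≤½ = ℚ.<⇒≤ (ℚ.positive⁻¹ ½)

½*-pos : ∀ {ε} → 0ℚ < ε → 0ℚ < ½ * ε
½*-pos = 0<* (ℚ.positive⁻¹ ½)

p≤∣p∣ : ∀ p → p ≤ ∣ p ∣
p≤∣p∣ p with ℚ.≤-total 0ℚ p
... | inj₁ p≥0 = ℚ.≤-reflexive (sym (ℚ.0≤p⇒∣p∣≡p p≥0))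
... | inj₂ p≤0 = ℚ.≤-trans p≤0 (ℚ.0≤∣p∣ p)

∣p∣≤ : ∀ {p q} → p ≤ q → - p ≤ q → ∣ p ∣ ≤ q
∣p∣≤ {p} p≤q -p≤q with ℚ.∣p∣≡p∨∣p∣≡-p p
... | inj₁ eq = subst (_≤ _) (sym eq) p≤q
... | inj₂ eq = subst (_≤ _) (sym eq) -p≤q

∣p-q∣≤⇒p≤ : ∀ {p q r} → ∣ p - q ∣ ≤ r → p ≤ q + r
∣p-q∣≤⇒p≤ {p} {q} {r} h = begin
  p            ≡⟨ solve 2 (λ p q → p := q :+ (p :- q)) refl p q ⟩
  q + (p - q)  ≤⟨ ℚ.+-monoʳ-≤ q (ℚ.≤-trans (p≤∣p∣ (p - q)) h) ⟩
  q + r        ∎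
  where open ℚ.≤-Reasoning

-- Archimedean property and decay of powers of one half

toℚᵘ-·1 : ∀ k → ℚ.toℚᵘ (k · 1ℚ) ℚᵘ.≃ mkℚᵘ (ℤ.+ k) 0
toℚᵘ-·1 zero    = ℚᵘ.*≡* refl
toℚᵘ-·1 (suc k) = ℚᵘ.≃-trans (ℚ.toℚᵘ-homo-+ 1ℚ (k · 1ℚ))
  (ℚᵘ.≃-trans (ℚᵘ.+-cong (ℚᵘ.*≡* {ℚ.toℚᵘ 1ℚ} {mkℚᵘ (ℤ.+ 1) 0} refl) (toℚᵘ-·1 k))
    (ℚᵘ.*≡* (cong (λ i → ((ℤ.+ 1) ℤ.+ i) ℤ.* (ℤ.+ 1)) (ℤ.*-identityʳ (ℤ.+ k)))))

-- The numerator bounds a nonnegative fraction, whose denominator is at least 1. The comparison is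
-- made on unnormalised fractions, where no common factors need cancelling.
archimedean : ∀ q → ∃ λ k → q ≤ k · 1ℚ
archimedean q@(mkℚ (ℤ.+ m) d _) = m , ℚ.toℚᵘ-cancel-≤
  (ℚᵘ.≤-respʳ-≃ (ℚᵘ.≃-sym (toℚᵘ-·1 m))
    (ℚᵘ.*≤* (ℤ.*-monoˡ-≤-nonNeg (ℤ.+ m) (ℤ.+≤+ (ℕ.s≤s ℕ.z≤n)))))
archimedean q@(mkℚ -[1+ _ ] _ _) = 0 , ℚ.<⇒≤ (ℚ.negative⁻¹ q)

½^-pos : ∀ k → 0ℚ < ½ ^ k
½^-pos zero    = ℚ.positive⁻¹ 1ℚ
½^-pos (suc k) = ½*-pos (½^-pos k)

½^-≤1 : ∀ k → ½ ^ k ≤ 1ℚ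
½^-≤1 zero    = ℚ.≤-refl
½^-≤1 (suc k) = ℚ.≤-trans (*-monoʳ-≤ 0≤½ (½^-≤1 k)) (ℚ.<⇒≤ (ℚ.*<* (ℤ.+<+ (ℕ.s≤s (ℕ.s≤s ℕ.z≤n)))))

-- This is `k < 2 ^ k` divided by the power; the step averages the induction hypothesis with
-- `½^-≤1`.
½^*·1-<1 : ∀ k → ½ ^ k * (k · 1ℚ) < 1ℚ
½^*·1-<1 zero    = ℚ.positive⁻¹ 1ℚ
½^*·1-<1 (suc k) = begin-strict
  (½ * h) * (1ℚ + c)
    ≡⟨ solve 2 (λ h c → (con ½ :* h) :* (con 1ℚ :+ c) := con ½ :* (h :+ h :* c)) refl h c ⟩
  ½ * (h + h * c)
    <⟨ ℚ.*-monoʳ-<-pos ½ (ℚ.+-mono-≤-< (½^-≤1 k) (½^*·1-<1 k)) ⟩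
  ½ * (1ℚ + 1ℚ)
    ≡⟨⟩
  1ℚ ∎
  where
  open ℚ.≤-Reasoning
  h = ½ ^ k
  c = k · 1ℚ

-- Choose `k` at least `w / ε` and apply `½^*·1-<1`.
½^*-vanishes : ∀ w {ε} → 0ℚ < ε → ∃ λ k → ½ ^ k * w < ε
½^*-vanishes w {ε} ε>0 = k , (begin-strict
  ½ ^ k * w                  ≡⟨ cong (½ ^ k *_) w≡ ⟨
  ½ ^ k * ((w * 1/ε) * ε)    ≤⟨ *-monoʳ-≤ (ℚ.<⇒≤ (½^-pos k)) (*-monoˡ-≤ (ℚ.<⇒≤ ε>0) q≤k) ⟩
  ½ ^ k * ((k · 1ℚ) * ε)     ≡⟨ ℚ.*-assoc (½ ^ k) (k · 1ℚ) ε ⟨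
  ½ ^ k * (k · 1ℚ) * ε       <⟨ ℚ.*-monoˡ-<-pos ε {{positive ε>0}} (½^*·1-<1 k) ⟩
  1ℚ * ε                     ≡⟨ ℚ.*-identityˡ ε ⟩
  ε                          ∎)
  where
  open ℚ.≤-Reasoning
  ε≢0 : ℚ.NonZero ε
  ε≢0 = ℚ.pos⇒nonZero ε {{positive ε>0}}
  1/ε : ℚ
  1/ε = (1/ ε) {{ε≢0}}
  k : ℕ
  k = proj₁ (archimedean (w * 1/ε))
  q≤k : w * 1/ε ≤ k · 1ℚ
  q≤k = proj₂ (archimedean (w * 1/ε))
  w≡ : (w * 1/ε) * ε ≡ w
  w≡ = trans (ℚ.*-assoc w 1/ε ε)
    (trans (cong (w *_) (ℚ.*-inverseˡ ε {{ε≢0}})) (ℚ.*-identityʳ w))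

-- Bisection

module Bisection {ℓ} {P : Pred ℚ ℓ} (P? : Decidable P) {b a : ℚ}
  (b≤a : b ≤ a) (Pa : P a) (¬Pb : ¬ P b) where

  mid : ℚ × ℚ → ℚ
  mid (l , h) = ½ * (l + h)

  -- The half kept is the one whose upper end satisfies `P` and whose lower end does not.
  halve : ℚ × ℚ → ℚ × ℚ
  halve i@(l , h) with P? (mid i)
  ... | yes _ = l , mid i
  ... | no  _ = mid i , h

  interval : ℕ → ℚ × ℚ
  interval zero    = b , a
  interval (suc n) = halve (interval n)

  lo hi : ℕ → ℚ
  lo n = proj₁ (interval n)
  hi n = proj₂ (interval n)

  P-hi : ∀ n → P (hi n)
  P-hi zero = Pa
  P-hi (suc n) with P? (mid (interval n))
  ... | yes Pm = Pm
  ... | no  _  = P-hi n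

  ¬P-lo : ∀ n → ¬ P (lo n)
  ¬P-lo zero = ¬Pb
  ¬P-lo (suc n) with P? (mid (interval n))
  ... | yes _  = ¬P-lo n
  ... | no ¬Pm = ¬Pm

  width : ∀ n → hi n - lo n ≡ ½ ^ n * (a - b)
  width zero = sym (ℚ.*-identityˡ (a - b))
  width (suc n) with P? (mid (interval n)) | width n
  ... | yes _ | ih = trans
    (trans (solve 2 (λ l h → con ½ :* (l :+ h) :- l := con ½ :* (h :- l)) refl (lo n) (hi n))
           (cong (½ *_) ih))
    (sym (ℚ.*-assoc ½ (½ ^ n) (a - b)))
  ... | no _ | ih = trans
    (trans (solve 2 (λ l h → h :- con ½ :* (l :+ h) := con ½ :* (h :- l)) refl (lo n) (hi n))
           (cong (½ *_) ih))
    (sym (ℚ.*-assoc ½ (½ ^ n) (a - b)))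

  lo≤hi : ∀ n → lo n ≤ hi n
  lo≤hi n = ≤-by-difference
    (solve 2 (λ l h → h := l :+ (h :- l)) refl (lo n) (hi n))
    (subst (0ℚ ≤_) (sym (width n)) (0≤* (ℚ.<⇒≤ (½^-pos n)) (0≤difference b≤a)))

  half-width : ∀ n → 0ℚ ≤ ½ * (hi n - lo n)
  half-width n = 0≤* 0≤½ (0≤difference (lo≤hi n))

  lo-step : ∀ n → lo n ≤ lo (suc n)
  lo-step n with P? (mid (interval n))
  ... | yes _ = ℚ.≤-refl
  ... | no  _ = ≤-by-difference
    (solve 2 (λ l h → con ½ :* (l :+ h) := l :+ con ½ :* (h :- l)) refl (lo n) (hi n)) (half-width n)

  hi-step : ∀ n → hi (suc n) ≤ hi n
  hi-step n with P? (mid (interval n))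
  ... | no  _ = ℚ.≤-refl
  ... | yes _ = ≤-by-difference
    (solve 2 (λ l h → h := con ½ :* (l :+ h) :+ con ½ :* (h :- l)) refl (lo n) (hi n)) (half-width n)

  nested : ∀ {m n} → m ℕ.≤′ n → lo m ≤ lo n × hi n ≤ hi m
  nested ℕ.≤′-refl = ℚ.≤-refl , ℚ.≤-refl
  nested (ℕ.≤′-step {n} m≤n) =
      ℚ.≤-trans (proj₁ (nested m≤n)) (lo-step n)
    , ℚ.≤-trans (hi-step n) (proj₂ (nested m≤n))

  lo-mono : ∀ {m n} → m ℕ.≤ n → lo m ≤ lo n
  lo-mono m≤n = proj₁ (nested (ℕ.≤⇒≤′ m≤n))

  hi-anti : ∀ {m n} → m ℕ.≤ n → hi n ≤ hi m
  hi-anti m≤n = proj₂ (nested (ℕ.≤⇒≤′ m≤n))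

  width≤ : ∀ {N n} → N ℕ.≤ n → hi n - lo n ≤ ½ ^ N * (a - b)
  width≤ {N} N≤n = subst (_ ≤_) (width N)
    (ℚ.+-mono-≤ (hi-anti N≤n) (ℚ.neg-antimono-≤ (lo-mono N≤n)))

  -- With a Lipschitz constant as `l`, this bounds the change of a function between the two end
  -- points.
  width-vanishes : ∀ {l ε} → 0ℚ ≤ l → 0ℚ < ε →
    ∃ λ N → ∀ {n} → N ℕ.≤ n → l * (hi n - lo n) < ε
  width-vanishes {l} {ε} l≥0 ε>0 with N , small ← ½^*-vanishes (l * (a - b)) ε>0
    = N , λ {n} N≤n → begin-strict
      l * (hi n - lo n)      ≤⟨ *-monoʳ-≤ l≥0 (width≤ N≤n) ⟩
      l * (½ ^ N * (a - b))  ≡⟨ solve 3 (λ l h w → l :* (h :* w) := h :* (l :* w)) refl l (½ ^ N) (a - b) ⟩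
      ½ ^ N * (l * (a - b))  <⟨ small ⟩
      ε                      ∎
    where open ℚ.≤-Reasoning

  hi-cauchy : IsCauchy hi
  hi-cauchy ε ε>0 with N , small ← ½^*-vanishes (a - b) ε>0
    = N , λ {m} {n} N≤m N≤n → ℚ.≤-<-trans
      (ℚ.≤-trans
        (∣p∣≤ (bound N≤m N≤n)
          (subst (_≤ _) (solve 2 (λ p q → q :- p := :- (p :- q)) refl (hi m) (hi n)) (bound N≤n N≤m)))
        (width≤ {N} ℕ.≤-refl))
      small
    where
    -- Both upper ends lie between `lo N` and `hi N`.
    bound : ∀ {N m n} → N ℕ.≤ m → N ℕ.≤ n → hi m - hi n ≤ hi N - lo N
    bound {n = n} N≤m N≤n = ℚ.+-mono-≤ (hi-anti N≤m)
      (ℚ.neg-antimono-≤ (ℚ.≤-trans (lo-mono N≤n) (lo≤hi n)))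

  limit : ℝ
  limit = mkℝ hi hi-cauchy

-- Powers

^-nonneg : ∀ {c} → 0ℚ ≤ c → ∀ k → 0ℚ ≤ c ^ k
^-nonneg c≥0 zero    = 0≤1
^-nonneg c≥0 (suc k) = 0≤* c≥0 (^-nonneg c≥0 k)

∣^∣≤ : ∀ {c x} → 0ℚ ≤ c → ∣ x ∣ ≤ c → ∀ k → ∣ x ^ k ∣ ≤ c ^ k
∣^∣≤ c≥0 ∣x∣≤c zero = ℚ.≤-refl
∣^∣≤ {c} {x} c≥0 ∣x∣≤c (suc k) = begin
  ∣ x * x ^ k ∣      ≡⟨ ℚ.∣p*q∣≡∣p∣*∣q∣ x (x ^ k) ⟩
  ∣ x ∣ * ∣ x ^ k ∣  ≤⟨ *-monoʳ-≤ (ℚ.0≤∣p∣ x) (∣^∣≤ c≥0 ∣x∣≤c k) ⟩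
  ∣ x ∣ * c ^ k      ≤⟨ *-monoˡ-≤ (^-nonneg c≥0 k) ∣x∣≤c ⟩
  c * c ^ k          ∎
  where open ℚ.≤-Reasoning

-- The recursive form of `k c^(k-1)`, the bound for the derivative of the `k`-th power on `[-c, c]`.
^-lipschitz : ℚ → ℕ → ℚ
^-lipschitz c zero    = 0ℚ
^-lipschitz c (suc k) = c * ^-lipschitz c k + c ^ k

^-lipschitz-nonneg : ∀ {c} → 0ℚ ≤ c → ∀ k → 0ℚ ≤ ^-lipschitz c k
^-lipschitz-nonneg c≥0 zero    = ℚ.≤-refl
^-lipschitz-nonneg c≥0 (suc k) = 0≤+ (0≤* c≥0 (^-lipschitz-nonneg c≥0 k)) (^-nonneg c≥0 k)

∣^-^∣≤ : ∀ {c x y} → 0ℚ ≤ c → ∣ x ∣ ≤ c → ∣ y ∣ ≤ c →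
  ∀ k → ∣ x ^ k - y ^ k ∣ ≤ ^-lipschitz c k * ∣ x - y ∣
∣^-^∣≤ {c} {x} {y} c≥0 ∣x∣≤c ∣y∣≤c zero = ℚ.≤-reflexive (sym (ℚ.*-zeroˡ ∣ x - y ∣))
∣^-^∣≤ {c} {x} {y} c≥0 ∣x∣≤c ∣y∣≤c (suc k) = begin
  ∣ x * x ^ k - y * y ^ k ∣
    ≡⟨ cong ∣_∣ (solve 4 (λ x y p q → x :* p :- y :* q := x :* (p :- q) :+ q :* (x :- y)) refl
         x y (x ^ k) (y ^ k)) ⟩
  ∣ x * (x ^ k - y ^ k) + y ^ k * (x - y) ∣
    ≤⟨ ℚ.∣p+q∣≤∣p∣+∣q∣ (x * (x ^ k - y ^ k)) (y ^ k * (x - y)) ⟩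
  ∣ x * (x ^ k - y ^ k) ∣ + ∣ y ^ k * (x - y) ∣
    ≡⟨ cong₂ _+_ (ℚ.∣p*q∣≡∣p∣*∣q∣ x (x ^ k - y ^ k)) (ℚ.∣p*q∣≡∣p∣*∣q∣ (y ^ k) (x - y)) ⟩
  ∣ x ∣ * ∣ x ^ k - y ^ k ∣ + ∣ y ^ k ∣ * d
    ≤⟨ ℚ.+-mono-≤
         (ℚ.≤-trans (*-monoʳ-≤ (ℚ.0≤∣p∣ x) (∣^-^∣≤ c≥0 ∣x∣≤c ∣y∣≤c k))
                    (*-monoˡ-≤ (0≤* (^-lipschitz-nonneg c≥0 k) (ℚ.0≤∣p∣ (x - y))) ∣x∣≤c))
         (*-monoˡ-≤ (ℚ.0≤∣p∣ (x - y)) (∣^∣≤ c≥0 ∣y∣≤c k)) ⟩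
  c * (^-lipschitz c k * d) + c ^ k * d
    ≡⟨ solve 4 (λ c l p d → c :* (l :* d) :+ p :* d := (c :* l :+ p) :* d) refl
         c (^-lipschitz c k) (c ^ k) d ⟩
  ^-lipschitz c (suc k) * d ∎
  where
  open ℚ.≤-Reasoning
  d = ∣ x - y ∣

-- Subsets

module _ {n p} {P : Pred (Fin n) p} (P? : Decidable P) where

  subset : Subset n
  subset = tabulate (does ∘ P?)

  ∈-subset⁺ : ∀ {v} → P v → v ∈ subset
  ∈-subset⁺ {v} Pv = Vec.lookup⇒[]= v subset
    (trans (Vec.lookup∘tabulate (does ∘ P?) v) (dec-true (P? v) Pv))

  ∈-subset⁻ : ∀ {v} → v ∈ subset → P v
  ∈-subset⁻ {v} v∈ with P? v | trans (sym (Vec.lookup∘tabulate (does ∘ P?) v)) (Vec.[]=⇒lookup v∈)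
  ... | yes Pv | _ = Pv
  ... | no  _  | ()

∉-∖ : ∀ {n} (S : Subset n) v → v ∉ S ∖ v
∉-∖ (_ ∷ S) zero    ()
∉-∖ (_ ∷ S) (suc v) (there v∈) = ∉-∖ S v v∈

∖⊆ : ∀ {n} (S : Subset n) v → S ∖ v ⊆ S
∖⊆ S v = p─q⊆p S _

⊆-∖ : ∀ {n} {S T : Subset n} {v} → S ⊆ T → v ∉ S → S ⊆ T ∖ v
⊆-∖ S⊆T v∉S u∈S = x∈p∧x≢y⇒x∈p-y (S⊆T u∈S) λ { refl → v∉S u∈S }

infixl 5 _∪｛_｝
_∪｛_｝ : ∀ {n} → Subset n → Fin n → Subset n
S ∪｛ v ｝ = S [ v ]≔ inside

∈-insert : ∀ {n} (S : Subset n) v → v ∈ S ∪｛ v ｝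
∈-insert (_ ∷ S) zero    = here
∈-insert (_ ∷ S) (suc v) = there (∈-insert S v)

⊆-insert : ∀ {n} (S : Subset n) v → S ⊆ S ∪｛ v ｝
⊆-insert (_ ∷ S) zero    here       = here
⊆-insert (_ ∷ S) zero    (there u∈) = there u∈
⊆-insert (_ ∷ S) (suc v) here       = here
⊆-insert (_ ∷ S) (suc v) (there u∈) = there (⊆-insert S v u∈)

∈-insert⁻ : ∀ {n} (S : Subset n) v {u} → u ∈ S ∪｛ v ｝ → u ≢ v → u ∈ S
∈-insert⁻ (_ ∷ S) zero    here       u≢v = contradiction refl u≢v
∈-insert⁻ (_ ∷ S) zero    (there u∈) u≢v = there u∈
∈-insert⁻ (_ ∷ S) (suc v) here       u≢v = here
∈-insert⁻ (_ ∷ S) (suc v) (there u∈) u≢v = there (∈-insert⁻ S v u∈ (u≢v ∘ cong suc))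

size-insert : ∀ {n} (S : Subset n) {v} → v ∉ S → size (S ∪｛ v ｝) ≡ suc (size S)
size-insert (inside  ∷ S) {zero}  v∉S = contradiction here v∉S
size-insert (outside ∷ S) {zero}  v∉S = refl
size-insert (inside  ∷ S) {suc v} v∉S = cong suc (size-insert S (v∉S ∘ there))
size-insert (outside ∷ S) {suc v} v∉S = size-insert S (v∉S ∘ there)

-- Sums over subsets

-- Branching on the first coordinate follows `allSubsets` and turns the lemmas below into structural
-- inductions.
Σ⊆ : ∀ n → (Subset n → ℚ) → ℚ
Σ⊆ zero    g = g []
Σ⊆ (suc n) g = Σ⊆ n (g ∘ (inside ∷_)) + Σ⊆ n (g ∘ (outside ∷_))

Σ⊆-cong : ∀ n {g h} → (∀ K → g K ≡ h K) → Σ⊆ n g ≡ Σ⊆ n h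
Σ⊆-cong zero    eq = eq []
Σ⊆-cong (suc n) eq = cong₂ _+_ (Σ⊆-cong n (eq ∘ (inside ∷_))) (Σ⊆-cong n (eq ∘ (outside ∷_)))

Σ⊆-+ : ∀ n g h → Σ⊆ n (λ K → g K + h K) ≡ Σ⊆ n g + Σ⊆ n h
Σ⊆-+ zero    g h = refl
Σ⊆-+ (suc n) g h = trans
  (cong₂ _+_ (Σ⊆-+ n (g ∘ (inside ∷_)) (h ∘ (inside ∷_))) (Σ⊆-+ n (g ∘ (outside ∷_)) (h ∘ (outside ∷_))))
  (solve 4 (λ a b c d → (a :+ b) :+ (c :+ d) := (a :+ c) :+ (b :+ d)) refl
    (Σ⊆ n (g ∘ (inside ∷_))) (Σ⊆ n (h ∘ (inside ∷_))) (Σ⊆ n (g ∘ (outside ∷_))) (Σ⊆ n (h ∘ (outside ∷_))))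

Σ⊆-* : ∀ n x g → Σ⊆ n (λ K → x * g K) ≡ x * Σ⊆ n g
Σ⊆-* zero    x g = refl
Σ⊆-* (suc n) x g = trans
  (cong₂ _+_ (Σ⊆-* n x (g ∘ (inside ∷_))) (Σ⊆-* n x (g ∘ (outside ∷_))))
  (sym (ℚ.*-distribˡ-+ x _ _))

Σ⊆-zero : ∀ n {g} → (∀ K → g K ≡ 0ℚ) → Σ⊆ n g ≡ 0ℚ
Σ⊆-zero zero    eq = eq []
Σ⊆-zero (suc n) eq = cong₂ _+_ (Σ⊆-zero n (eq ∘ (inside ∷_))) (Σ⊆-zero n (eq ∘ (outside ∷_)))

Σ⊆-⊥ : ∀ n {g} → (∀ K v → v ∈ K → g K ≡ 0ℚ) → Σ⊆ n g ≡ g ⊥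
Σ⊆-⊥ zero    eq = refl
Σ⊆-⊥ (suc n) eq = trans
  (cong₂ _+_ (Σ⊆-zero n (λ K → eq (inside ∷ K) zero here))
             (Σ⊆-⊥ n (λ K v v∈K → eq (outside ∷ K) (suc v) (there v∈K))))
  (ℚ.+-identityˡ _)

Σ⊆-nonneg : ∀ n {g} → (∀ K → 0ℚ ≤ g K) → 0ℚ ≤ Σ⊆ n g
Σ⊆-nonneg zero    h = h []
Σ⊆-nonneg (suc n) h = 0≤+ (Σ⊆-nonneg n (h ∘ (inside ∷_))) (Σ⊆-nonneg n (h ∘ (outside ∷_)))

Σ⊆-lipschitz : ∀ n {g h l d} → (∀ K → ∣ g K - h K ∣ ≤ l K * d) →
  ∣ Σ⊆ n g - Σ⊆ n h ∣ ≤ Σ⊆ n l * d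
Σ⊆-lipschitz zero    bound = bound []
Σ⊆-lipschitz (suc n) {g} {h} {l} {d} bound = begin
  ∣ (g₁ + g₀) - (h₁ + h₀) ∣
    ≡⟨ cong ∣_∣ (solve 4 (λ a b c d → (a :+ b) :- (c :+ d) := (a :- c) :+ (b :- d)) refl g₁ g₀ h₁ h₀) ⟩
  ∣ (g₁ - h₁) + (g₀ - h₀) ∣
    ≤⟨ ℚ.∣p+q∣≤∣p∣+∣q∣ (g₁ - h₁) (g₀ - h₀) ⟩
  ∣ g₁ - h₁ ∣ + ∣ g₀ - h₀ ∣
    ≤⟨ ℚ.+-mono-≤ (Σ⊆-lipschitz n (bound ∘ (inside ∷_))) (Σ⊆-lipschitz n (bound ∘ (outside ∷_))) ⟩
  Σ⊆ n (l ∘ (inside ∷_)) * d + Σ⊆ n (l ∘ (outside ∷_)) * d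
    ≡⟨ ℚ.*-distribʳ-+ d (Σ⊆ n (l ∘ (inside ∷_))) (Σ⊆ n (l ∘ (outside ∷_))) ⟨
  Σ⊆ (suc n) l * d ∎
  where
  open ℚ.≤-Reasoning
  g₁ = Σ⊆ n (g ∘ (inside ∷_))
  g₀ = Σ⊆ n (g ∘ (outside ∷_))
  h₁ = Σ⊆ n (h ∘ (inside ∷_))
  h₀ = Σ⊆ n (h ∘ (outside ∷_))

-- K ↦ K ∪ ⁅ v ⁆ is a bijection from the sets avoiding v to those containing v.
Σ⊆-shift : ∀ {n} (v : Fin n) {g h : Subset n → ℚ} →
  (∀ K → v ∉ K → g K ≡ 0ℚ) → (∀ K → v ∈ K → h K ≡ 0ℚ) →
  (∀ K → v ∉ K → g (K ∪｛ v ｝) ≡ h K) → Σ⊆ n g ≡ Σ⊆ n h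
Σ⊆-shift {suc n} zero {h = h} g≡0 h≡0 shift = trans
  (cong₂ _+_ (Σ⊆-cong n (λ K → shift (outside ∷ K) λ ()))
             (Σ⊆-zero n (λ K → g≡0 (outside ∷ K) λ ())))
  (trans (ℚ.+-comm (Σ⊆ n (h ∘ (outside ∷_))) 0ℚ)
    (cong (_+ Σ⊆ n (h ∘ (outside ∷_))) (sym (Σ⊆-zero n (λ K → h≡0 (inside ∷ K) here)))))
Σ⊆-shift {suc n} (suc v) {g} {h} g≡0 h≡0 shift = cong₂ _+_ (half inside) (half outside)
  where
  half : ∀ s → Σ⊆ n (g ∘ (s ∷_)) ≡ Σ⊆ n (h ∘ (s ∷_))
  half s = Σ⊆-shift v
    (λ K v∉K → g≡0 (s ∷ K) (v∉K ∘ drop-there))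
    (λ K v∈K → h≡0 (s ∷ K) (there v∈K))
    (λ K v∉K → shift (s ∷ K) (v∉K ∘ drop-there))

-- Sums over lists of subsets, and indicators

Σᴸ : ∀ {n} → (Subset n → ℚ) → List (Subset n) → ℚ
Σᴸ g = foldr (λ K q → g K + q) 0ℚ

Σᴸ-++ : ∀ {n} (g : Subset n → ℚ) ks ls → Σᴸ g (ks ++ ls) ≡ Σᴸ g ks + Σᴸ g ls
Σᴸ-++ g []       ls = sym (ℚ.+-identityˡ _)
Σᴸ-++ g (K ∷ ks) ls = trans (cong (g K +_) (Σᴸ-++ g ks ls)) (sym (ℚ.+-assoc (g K) _ _))

Σᴸ-map : ∀ {m n} (g : Subset n → ℚ) (φ : Subset m → Subset n) ks → Σᴸ g (map φ ks) ≡ Σᴸ (g ∘ φ) ks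
Σᴸ-map g φ []       = refl
Σᴸ-map g φ (K ∷ ks) = cong (g (φ K) +_) (Σᴸ-map g φ ks)

Σᴸ-allSubsets : ∀ n g → Σᴸ g (allSubsets n) ≡ Σ⊆ n g
Σᴸ-allSubsets zero    g = ℚ.+-identityʳ (g [])
Σᴸ-allSubsets (suc n) g = trans
  (Σᴸ-++ g (map (inside ∷_) (allSubsets n)) (map (outside ∷_) (allSubsets n)))
  (cong₂ _+_
    (trans (Σᴸ-map g (inside ∷_) (allSubsets n)) (Σᴸ-allSubsets n (g ∘ (inside ∷_))))
    (trans (Σᴸ-map g (outside ∷_) (allSubsets n)) (Σᴸ-allSubsets n (g ∘ (outside ∷_)))))

-- With an indicator in each term, sums over different families of cliques share one index set and
-- can be compared termwise.
when : ∀ {p} {P : Set p} → Dec P → ℚ → ℚ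
when P? q = if does P? then q else 0ℚ

when-yes : ∀ {p} {P : Set p} (P? : Dec P) {q} → P → when P? q ≡ q
when-yes P? {q} p = cong (if_then q else 0ℚ) (dec-true P? p)

when-no : ∀ {p} {P : Set p} (P? : Dec P) {q} → ¬ P → when P? q ≡ 0ℚ
when-no P? {q} ¬p = cong (if_then q else 0ℚ) (dec-false P? ¬p)

when-cong : ∀ {p q} {P : Set p} {Q : Set q} (P? : Dec P) (Q? : Dec Q) {r} →
  (P → Q) → (Q → P) → when P? r ≡ when Q? r
when-cong (yes _) (yes _) _   _   = refl
when-cong (yes p) (no ¬q) P⇒Q _   = contradiction (P⇒Q p) ¬q
when-cong (no ¬p) (yes q) _   Q⇒P = contradiction (Q⇒P q) ¬p
when-cong (no _)  (no _)  _   _   = refl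

when-* : ∀ {p} {P : Set p} (P? : Dec P) x q → when P? (x * q) ≡ x * when P? q
when-* (yes _) x q = refl
when-* (no _)  x q = sym (ℚ.*-zeroʳ x)

Σᴸ-filter : ∀ {n p} {P : Pred (Subset n) p} (P? : Decidable P) g ks →
  Σᴸ g (filter P? ks) ≡ Σᴸ (λ K → when (P? K) (g K)) ks
Σᴸ-filter P? g [] = refl
Σᴸ-filter P? g (K ∷ ks) with does (P? K)
... | true  = cong (g K +_) (Σᴸ-filter P? g ks)
... | false = trans (Σᴸ-filter P? g ks) (sym (ℚ.+-identityˡ _))

-- Clique polynomials at rational points

sum-unit : ∀ {m} k (g : ℕ → ℚ) → k ℕ.< m →
  sum {m} (λ i → when (k ℕ.≟ toℕ i) (g (toℕ i))) ≡ g k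
sum-unit {suc m} zero g _ = trans
  -- `0 ℕ.≟ suc i` computes to a negative answer, so all later summands are `0ℚ` by computation.
  (cong (g 0 +_) (trans (sum-cong-≗ {m} (λ i → refl)) (sum-replicate-zero m)))
  (ℚ.+-identityʳ (g 0))
sum-unit {suc m} (suc k) g (ℕ.s≤s k<m) = trans (ℚ.+-identityˡ _)
  (trans (sum-cong-≗ {m} λ i → refl) (sum-unit k (g ∘ suc) k<m))

-- Coefficients count sets by size, while the deletion recurrence needs one term per set. A set
-- added to the list raises exactly one coefficient by one, that of its size.
sum-by-size : ∀ {n} m (g : ℕ → ℚ) (ks : List (Subset n)) → All (λ K → size K ℕ.< m) ks →
  sum {m} (λ i → length (filter (λ K → size K ℕ.≟ toℕ i) ks) · g (toℕ i)) ≡ Σᴸ (g ∘ size) ks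
sum-by-size m g [] [] = sum-replicate-zero m
sum-by-size m g (K ∷ ks) (K<m ∷ ks<m) = begin
  sum {m} (λ i → length (filter (λ K → size K ℕ.≟ toℕ i) (K ∷ ks)) · g (toℕ i))
    ≡⟨ sum-cong-≗ {m} split ⟩
  sum {m} (λ i → when (size K ℕ.≟ toℕ i) (g (toℕ i)) + length (filter (λ K → size K ℕ.≟ toℕ i) ks) · g (toℕ i))
    ≡⟨ ∑-distrib-+ {m} (λ i → when (size K ℕ.≟ toℕ i) (g (toℕ i))) _ ⟩
  _ ≡⟨ cong₂ _+_ (sum-unit (size K) g K<m) (sum-by-size m g ks ks<m) ⟩
  g (size K) + Σᴸ (g ∘ size) ks ∎
  where
  open ≡-Reasoning
  split : ∀ i → length (filter (λ K → size K ℕ.≟ toℕ i) (K ∷ ks)) · g (toℕ i) ≡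
    when (size K ℕ.≟ toℕ i) (g (toℕ i)) + length (filter (λ K → size K ℕ.≟ toℕ i) ks) · g (toℕ i)
  split i with does (size K ℕ.≟ toℕ i)
  ... | true  = refl
  ... | false = sym (ℚ.+-identityˡ _)

-- Ensures that cutting the polynomial off at the clique number loses no clique.
size≤max : ∀ {n} (ks : List (Subset n)) → All (λ K → size K ℕ.≤ foldr ℕ._⊔_ 0 (map size ks)) ks
size≤max []       = []
size≤max (K ∷ ks) = ℕ.m≤m⊔n _ _ ∷ All.map (λ h → ℕ.≤-trans h (ℕ.m≤n⊔m (size K) _)) (size≤max ks)

seq-·ʳ : ∀ k x n → seq (k ·ʳ x) n ≡ k · seq x n
seq-·ʳ zero    x n = refl
seq-·ʳ (suc k) x n = cong (seq x n +_) (seq-·ʳ k x n)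

seq-^ʳ : ∀ x k n → seq (x ^ʳ k) n ≡ seq x n ^ k
seq-^ʳ x zero    n = refl
seq-^ʳ x (suc k) n = cong (seq x n *_) (seq-^ʳ x k n)

seq-sumʳ : ∀ {m} (t : Fin m → ℝ) n → seq (sumʳ t) n ≡ sum (λ i → seq (t i) n)
seq-sumʳ {zero}  t n = refl
seq-sumʳ {suc m} t n = cong (seq (t zero) n +_) (seq-sumʳ (t ∘ suc) n)

module CliqueSum (G : Graph) where
  open Graph G

  IsCliqueIn : Subset order → Pred (Subset order) _
  IsCliqueIn S K = K ⊆ S × IsClique K

  isCliqueIn? : ∀ S → Decidable (IsCliqueIn S)
  isCliqueIn? S K = (K ⊆? S) ×-dec isClique? K

  term : ℚ → Subset order → Subset order → ℚ
  term x S K = when (isCliqueIn? S K) (x ^ size K)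

  cliqueSum : ℚ → Subset order → ℚ
  cliqueSum x S = Σ⊆ order (term x S)

  -- Real operations are termwise, so this is an equality at every index; the analysis can thus be
  -- done at rational points.
  seq-cliquePoly : ∀ B x n → seq (cliquePoly G B x) n ≡ cliqueSum (seq x n) B
  seq-cliquePoly B x n = begin
    seq (cliquePoly G B x) n
      ≡⟨ seq-sumʳ {m} (λ i → cliqueCount G B (toℕ i) ·ʳ (x ^ʳ toℕ i)) n ⟩
    sum {m} (λ i → seq (cliqueCount G B (toℕ i) ·ʳ (x ^ʳ toℕ i)) n)
      ≡⟨ sum-cong-≗ {m} (λ i → trans (seq-·ʳ (cliqueCount G B (toℕ i)) (x ^ʳ toℕ i) n)
           (cong (cliqueCount G B (toℕ i) ·_) (seq-^ʳ x (toℕ i) n))) ⟩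
    sum {m} (λ i → cliqueCount G B (toℕ i) · (seq x n ^ toℕ i))
      ≡⟨ sum-by-size m (seq x n ^_) (cliquesIn G B) (All.map ℕ.s≤s (size≤max (cliquesIn G B))) ⟩
    Σᴸ ((seq x n ^_) ∘ size) (cliquesIn G B)
      ≡⟨ Σᴸ-filter (isCliqueIn? B) _ (allSubsets order) ⟩
    Σᴸ (term (seq x n) B) (allSubsets order)
      ≡⟨ Σᴸ-allSubsets order _ ⟩
    cliqueSum (seq x n) B ∎
    where
    open ≡-Reasoning
    m = suc (cliqueNumber G B)

  -- Deletion of a vertex

  N : Vertex → Subset order
  N v = subset (v ~?_)

  -- With `restrict-clique`, this matches the cliques in `S` through `v` with the cliques in
  -- `S ∩ N v`.
  extend-clique : ∀ {S K v} → v ∈ S → IsCliqueIn (S ∩ N v) K → IsCliqueIn S (K ∪｛ v ｝)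
  extend-clique {S} {K} {v} v∈S (K⊆ , clique) = ⊆S , clique′
    where
    ⊆S : K ∪｛ v ｝ ⊆ S
    ⊆S {u} u∈ with u Fin.≟ v
    ... | yes refl = v∈S
    ... | no  u≢v  = p∩q⊆p S (N v) (K⊆ (∈-insert⁻ K v u∈ u≢v))
    v~ : ∀ {u} → u ∈ K → v ~ u
    v~ u∈K = ∈-subset⁻ (v ~?_) (p∩q⊆q S (N v) (K⊆ u∈K))
    clique′ : IsClique (K ∪｛ v ｝)
    clique′ u w u∈ w∈ u≢w with u Fin.≟ v | w Fin.≟ v
    ... | yes refl | yes refl = contradiction refl u≢w
    ... | yes refl | no w≢v   = v~ (∈-insert⁻ K v w∈ w≢v)
    ... | no u≢v   | yes refl = sym~ (v~ (∈-insert⁻ K v u∈ u≢v))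
    ... | no u≢v   | no w≢v   = clique u w (∈-insert⁻ K v u∈ u≢v) (∈-insert⁻ K v w∈ w≢v) u≢w

  restrict-clique : ∀ {S K v} → v ∉ K → IsCliqueIn S (K ∪｛ v ｝) → IsCliqueIn (S ∩ N v) K
  restrict-clique {S} {K} {v} v∉K (K⊆ , clique) =
      (λ u∈K → x∈p∩q⁺ (K⊆ (⊆-insert K v u∈K) , ∈-subset⁺ (v ~?_)
        (clique _ _ (∈-insert K v) (⊆-insert K v u∈K) λ { refl → v∉K u∈K })))
    , λ u w u∈K w∈K → clique u w (⊆-insert K v u∈K) (⊆-insert K v w∈K)

  -- The cliques avoiding `v` give the first summand. Those containing `v` correspond to cliques in
  -- `S ∩ N v` with one vertex less, which accounts for the factor `x`.
  cliqueSum-remove : ∀ x {S v} → v ∈ S →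
    cliqueSum x S ≡ cliqueSum x (S ∖ v) + x * cliqueSum x (S ∩ N v)
  cliqueSum-remove x {S} {v} v∈S = begin
    cliqueSum x S
      ≡⟨ Σ⊆-cong order split ⟩
    Σ⊆ order (λ K → term x (S ∖ v) K + when (v ∈? K) (term x S K))
      ≡⟨ Σ⊆-+ order (term x (S ∖ v)) _ ⟩
    cliqueSum x (S ∖ v) + Σ⊆ order (λ K → when (v ∈? K) (term x S K))
      ≡⟨ cong (cliqueSum x (S ∖ v) +_) (Σ⊆-shift v (λ K → when-no (v ∈? K)) vanish shift) ⟩
    cliqueSum x (S ∖ v) + Σ⊆ order (λ K → x * term x (S ∩ N v) K)
      ≡⟨ cong (cliqueSum x (S ∖ v) +_) (Σ⊆-* order x (term x (S ∩ N v))) ⟩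
    cliqueSum x (S ∖ v) + x * cliqueSum x (S ∩ N v) ∎
    where
    open ≡-Reasoning

    split : ∀ K → term x S K ≡ term x (S ∖ v) K + when (v ∈? K) (term x S K)
    split K with v ∈? K
    ... | yes v∈K = sym (trans
      (cong (_+ term x S K) (when-no (isCliqueIn? (S ∖ v) K) λ (K⊆ , _) → ∉-∖ S v (K⊆ v∈K)))
      (ℚ.+-identityˡ (term x S K)))
    ... | no  v∉K = trans
      (when-cong (isCliqueIn? S K) (isCliqueIn? (S ∖ v) K)
        (λ (K⊆ , clique) → ⊆-∖ K⊆ v∉K , clique)
        (λ (K⊆ , clique) → ∖⊆ S v ∘ K⊆ , clique))
      (sym (ℚ.+-identityʳ (term x (S ∖ v) K)))

    vanish : ∀ K → v ∈ K → x * term x (S ∩ N v) K ≡ 0ℚ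
    vanish K v∈K = trans
      (cong (x *_) (when-no (isCliqueIn? (S ∩ N v) K) λ (K⊆ , _) →
        irrefl refl (∈-subset⁻ (v ~?_) (p∩q⊆q S (N v) (K⊆ v∈K)))))
      (ℚ.*-zeroʳ x)

    shift : ∀ K → v ∉ K →
      when (v ∈? K ∪｛ v ｝) (term x S (K ∪｛ v ｝)) ≡ x * term x (S ∩ N v) K
    shift K v∉K = begin
      when (v ∈? K ∪｛ v ｝) (term x S (K ∪｛ v ｝))
        ≡⟨ when-yes (v ∈? K ∪｛ v ｝) (∈-insert K v) ⟩
      when (isCliqueIn? S (K ∪｛ v ｝)) (x ^ size (K ∪｛ v ｝))
        ≡⟨ when-cong (isCliqueIn? S (K ∪｛ v ｝)) (isCliqueIn? (S ∩ N v) K)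
             (restrict-clique v∉K) (extend-clique v∈S) ⟩
      when (isCliqueIn? (S ∩ N v) K) (x ^ size (K ∪｛ v ｝))
        ≡⟨ cong (λ k → when (isCliqueIn? (S ∩ N v) K) (x ^ k)) (size-insert K v∉K) ⟩
      when (isCliqueIn? (S ∩ N v) K) (x * x ^ size K)
        ≡⟨ when-* (isCliqueIn? (S ∩ N v) K) x (x ^ size K) ⟩
      x * term x (S ∩ N v) K ∎

  cliqueSum-⊥ : ∀ x → cliqueSum x ⊥ ≡ 1ℚ
  cliqueSum-⊥ x = trans
    (Σ⊆-⊥ order λ K v v∈K → when-no (isCliqueIn? ⊥ K) λ (K⊆ , _) → ∉⊥ (K⊆ v∈K))
    (trans (when-yes (isCliqueIn? ⊥ ⊥) (⊆-refl , λ u v u∈ → contradiction u∈ ∉⊥))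
      (cong (x ^_) (∣⊥∣≡0 order)))

  cliqueSum-lipschitz : ∀ {c} → 0ℚ ≤ c → ∃ λ l → 0ℚ ≤ l ×
    (∀ S {x y} → ∣ x ∣ ≤ c → ∣ y ∣ ≤ c → ∣ cliqueSum x S - cliqueSum y S ∣ ≤ l * ∣ x - y ∣)
  cliqueSum-lipschitz {c} c≥0 =
      -- Summing over all subsets, cliques or not, makes the constant independent of `S`.
      Σ⊆ order (λ K → ^-lipschitz c (size K))
    , Σ⊆-nonneg order (λ K → ^-lipschitz-nonneg c≥0 (size K))
    , λ S {x} {y} ∣x∣≤c ∣y∣≤c → Σ⊆-lipschitz order (bound S ∣x∣≤c ∣y∣≤c)
    where
    bound : ∀ S {x y} → ∣ x ∣ ≤ c → ∣ y ∣ ≤ c → ∀ K →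
      ∣ term x S K - term y S K ∣ ≤ ^-lipschitz c (size K) * ∣ x - y ∣
    bound S {x} {y} ∣x∣≤c ∣y∣≤c K with does (isCliqueIn? S K)
    ... | true  = ∣^-^∣≤ c≥0 ∣x∣≤c ∣y∣≤c (size K)
    ... | false = 0≤* (^-lipschitz-nonneg c≥0 (size K)) (ℚ.0≤∣p∣ (x - y))

-- Functions of vertex sets satisfying the clique recurrence

-- The case split for inductions that shrink `S` to `A` one vertex at a time.
⊆-or-removable : ∀ {n} {A S : Subset n} → A ⊆ S → A ≡ S ⊎ ∃ λ v → v ∈ S × A ⊆ S ∖ v
⊆-or-removable {A = A} {S} A⊆S with Fin.any? (λ v → (v ∈? S) ×-dec ¬? (v ∈? A))
... | yes (v , v∈S , v∉A) = inj₂ (v , v∈S , ⊆-∖ A⊆S v∉A)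
... | no  none            = inj₁ (⊆-antisym A⊆S
  λ {v} v∈S → decidable-stable (v ∈? A) λ v∉A → none (v , v∈S , v∉A))

module _ {n : ℕ} where

  -- Stated without a graph so that it also covers the clique sums of `G` pulled back along a
  -- section to subsets of `H`.
  record CliqueRecurrence (x : ℚ) (N : Fin n → Subset n) (W : Subset n → ℚ) : Set where
    field
      v∉N      : ∀ v → v ∉ N v
      W-⊥      : W ⊥ ≡ 1ℚ
      W-remove : ∀ {S v} → v ∈ S → W S ≡ W (S ∖ v) + x * W (S ∩ N v)

    ∩N⊆∖ : ∀ S v → S ∩ N v ⊆ S ∖ v
    ∩N⊆∖ S v = ⊆-∖ (p∩q⊆p S (N v)) (v∉N v ∘ p∩q⊆q S (N v))

  open CliqueRecurrence

  W-at-0 : ∀ {N W} → CliqueRecurrence 0ℚ N W → ∀ S → W S ≡ 1ℚ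
  W-at-0 {N} {W} R S = go (⊂-wellFounded S)
    where
    go : ∀ {S} → Acc _⊂_ S → W S ≡ 1ℚ
    go {S} (acc rec) with ⊆-or-removable (⊆-min S)
    ... | inj₁ refl = W-⊥ R
    ... | inj₂ (v , v∈S , _) = trans (W-remove R v∈S)
      (cong₂ _+_ (go (rec (x∈p⇒p-x⊂p v∈S))) (ℚ.*-zeroˡ (W (S ∩ N v))))

  module _ {x : ℚ} (x≤0 : x ≤ 0ℚ) where

    -- Deleting `v` adds `- x * W (S ∩ N v)`, a product of nonnegative factors.
    W-antitone : ∀ {N W B} → CliqueRecurrence x N W → (∀ {S} → S ⊆ B → 0ℚ < W S) →
      ∀ {A S} → S ⊆ B → A ⊆ S → W S ≤ W A
    W-antitone {N} {W} {B} R W>0 = go (⊂-wellFounded _)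
      where
      go : ∀ {A S} → Acc _⊂_ S → S ⊆ B → A ⊆ S → W S ≤ W A
      go {A} {S} (acc rec) S⊆B A⊆S with ⊆-or-removable A⊆S
      ... | inj₁ refl = ℚ.≤-refl
      ... | inj₂ (v , v∈S , A⊆S∖v) = ℚ.≤-trans
        (≤-by-difference
          (trans (solve 3 (λ w x u → w := (w :+ x :* u) :+ (:- x) :* u) refl (W (S ∖ v)) x (W (S ∩ N v)))
                 (cong (_+ (- x) * W (S ∩ N v)) (sym (W-remove R v∈S))))
          (0≤* (0≤-neg x≤0) (ℚ.<⇒≤ (W>0 (S⊆B ∘ p∩q⊆p S (N v))))))
        (go (rec (x∈p⇒p-x⊂p v∈S)) (S⊆B ∘ ∖⊆ S v) A⊆S∖v)

    module _ {N M F Q} (RF : CliqueRecurrence x N F) (RQ : CliqueRecurrence x M Q)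
      (N⊆M : ∀ v → N v ⊆ M v) {B} (F>0 : ∀ {S} → S ⊆ B → 0ℚ < F S) where

      private
        -- Q S ∕ F S is monotone in S.
        ratio : ∀ {A S} → Acc _⊂_ S → S ⊆ B → A ⊆ S → F S * Q A ≤ Q S * F A

        -- The case `A = ⊥` of `ratio`, where both functions equal 1. The recursion is mutual:
        -- `ratio` needs this inequality at the smaller set.
        F≤Q′ : ∀ {S} → Acc _⊂_ S → S ⊆ B → F S ≤ Q S
        F≤Q′ {S} rec S⊆B = subst₂ _≤_
          (trans (cong (F S *_) (W-⊥ RQ)) (ℚ.*-identityʳ (F S)))
          (trans (cong (Q S *_) (W-⊥ RF)) (ℚ.*-identityʳ (Q S)))
          (ratio rec S⊆B (⊆-min S))

        ratio {A} {S} (acc rec) S⊆B A⊆S with ⊆-or-removable A⊆S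
        ... | inj₁ refl = ℚ.≤-reflexive (ℚ.*-comm (F S) (Q S))
        -- The ratio grows from `A` to `S′` by induction and from `S′` to `S` by `one-step`; after
        -- cross-multiplication the factor `F S′` is cancelled.
        ... | inj₂ (v , v∈S , A⊆S′) = ℚ.*-cancelˡ-≤-pos (F S′) {{positive (F>0 S′⊆B)}} (begin
          F S′ * (F S * Q A)   ≡⟨ solve 3 (λ a b c → a :* (b :* c) := b :* (a :* c)) refl (F S′) (F S) (Q A) ⟩
          F S * (F S′ * Q A)   ≤⟨ *-monoʳ-≤ (ℚ.<⇒≤ (F>0 S⊆B)) (ratio (rec smaller) S′⊆B A⊆S′) ⟩
          F S * (Q S′ * F A)   ≡⟨ ℚ.*-assoc (F S) (Q S′) (F A) ⟨
          F S * Q S′ * F A     ≤⟨ *-monoˡ-≤ (ℚ.<⇒≤ (F>0 (S⊆B ∘ A⊆S))) one-step ⟩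
          Q S * F S′ * F A     ≡⟨ solve 3 (λ a b c → a :* b :* c := b :* (a :* c)) refl (Q S) (F S′) (F A) ⟩
          F S′ * (Q S * F A)   ∎)
          where
          open ℚ.≤-Reasoning
          S′ = S ∖ v
          S′⊆B : S′ ⊆ B
          S′⊆B = S⊆B ∘ ∖⊆ S v
          smaller : S′ ⊂ S
          smaller = x∈p⇒p-x⊂p v∈S

          -- The ratio at `S ∩ M v` is at most that at `S′`. Passing to the smaller set `S ∩ N v`
          -- can only increase `F`, and `Q S′` is nonnegative because it is at least `F S′`.
          neighbours : Q (S ∩ M v) * F S′ ≤ F (S ∩ N v) * Q S′
          neighbours = begin
            Q (S ∩ M v) * F S′  ≡⟨ ℚ.*-comm (Q (S ∩ M v)) (F S′) ⟩
            F S′ * Q (S ∩ M v)  ≤⟨ ratio (rec smaller) S′⊆B (∩N⊆∖ RQ S v) ⟩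
            Q S′ * F (S ∩ M v)  ≤⟨ *-monoʳ-≤ (ℚ.≤-trans (ℚ.<⇒≤ (F>0 S′⊆B)) (F≤Q′ (rec smaller) S′⊆B))
                                     (W-antitone RF F>0 (S⊆B ∘ p∩q⊆p S (M v))
                                       (λ u∈ → x∈p∩q⁺ (p∩q⊆p S (N v) u∈ , N⊆M v (p∩q⊆q S (N v) u∈)))) ⟩
            Q S′ * F (S ∩ N v)  ≡⟨ ℚ.*-comm (Q S′) (F (S ∩ N v)) ⟩
            F (S ∩ N v) * Q S′  ∎

          -- After expanding `F S` and `Q S`, the two sides differ by `- x` times the gap in
          -- `neighbours`.
          one-step : F S * Q S′ ≤ Q S * F S′
          one-step = subst₂ _≤_
            (cong (_* Q S′) (sym (W-remove RF v∈S))) (cong (_* F S′) (sym (W-remove RQ v∈S)))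
            (≤-by-difference
              (solve 5 (λ f q x g r → (q :+ x :* r) :* f := (f :+ x :* g) :* q :+ (:- x) :* (g :* q :- r :* f))
                refl (F S′) (Q S′) x (F (S ∩ N v)) (Q (S ∩ M v)))
              (0≤* (0≤-neg x≤0) (0≤difference neighbours)))

      W-comparison : ∀ {S} → S ⊆ B → F S ≤ Q S
      W-comparison = F≤Q′ (⊂-wellFounded _)

-- Roots below which positivity fails

module Roots (G : Graph) where
  open Graph G
  open CliqueSum G public

  recurrence : ∀ x → CliqueRecurrence x N (cliqueSum x)
  recurrence x = record
    { v∉N      = λ v v∈N → irrefl refl (∈-subset⁻ (v ~?_) v∈N)
    ; W-⊥      = cliqueSum-⊥ x
    ; W-remove = cliqueSum-remove x
    }

  AllPositive : Subset order → Pred ℚ _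
  AllPositive B x = ∀ {S} → S ⊆ B → 0ℚ < cliqueSum x S

  module _ (B : Subset order) where

    nonpositive? : ∀ x → Dec (∃ λ S → S ⊆ B × cliqueSum x S ≤ 0ℚ)
    nonpositive? x = anySubset? λ S → (S ⊆? B) ×-dec (cliqueSum x S ℚ.≤? 0ℚ)

    -- There are finitely many subsets and the values are rational, so bisection can test this
    -- predicate.
    allPositive? : Decidable (AllPositive B)
    allPositive? x with nonpositive? x
    ... | yes (S , S⊆B , S≤0) = no λ pos → ℚ.<-irrefl refl (ℚ.<-≤-trans (pos S⊆B) S≤0)
    ... | no  none            = yes λ {S} S⊆B → ℚ.≰⇒> λ S≤0 → none (S , S⊆B , S≤0)

    ¬allPositive : ∀ {x} → ¬ AllPositive B x → ∃ λ S → S ⊆ B × cliqueSum x S ≤ 0ℚ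
    ¬allPositive {x} ¬pos = decidable-stable (nonpositive? x) λ none →
      ¬pos λ {S} S⊆B → ℚ.≰⇒> λ S≤0 → none (S , S⊆B , S≤0)

    allPositive-0 : AllPositive B 0ℚ
    allPositive-0 {S} _ = subst (0ℚ <_) (sym (W-at-0 (recurrence 0ℚ) S)) (ℚ.positive⁻¹ 1ℚ)

    module _ {b : ℚ} (b≤0 : b ≤ 0ℚ) (¬pos : ¬ AllPositive B b) where
      private
        module I = Bisection allPositive? b≤0 allPositive-0 ¬pos
      open I using (lo; hi)

      private
        -- On `[b , 0]` absolute values are at most `- b`.
        lip = cliqueSum-lipschitz (0≤-neg b≤0)
        l   = proj₁ lip
        l≥0 = proj₁ (proj₂ lip)

        ∣∣≤ : ∀ {x} → b ≤ x → x ≤ 0ℚ → ∣ x ∣ ≤ - b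
        ∣∣≤ b≤x x≤0 = ∣p∣≤ (ℚ.≤-trans x≤0 (0≤-neg b≤0)) (ℚ.neg-antimono-≤ b≤x)

        b≤lo : ∀ n → b ≤ lo n
        b≤lo n = I.lo-mono {0} {n} ℕ.z≤n

        b≤hi : ∀ n → b ≤ hi n
        b≤hi n = ℚ.≤-trans (b≤lo n) (I.lo≤hi n)

        hi≤0 : ∀ n → hi n ≤ 0ℚ
        hi≤0 n = I.hi-anti {0} {n} ℕ.z≤n

        lipschitz : ∀ S {x y} → b ≤ x → x ≤ y → y ≤ 0ℚ →
          cliqueSum y S ≤ cliqueSum x S + l * (y - x) × cliqueSum x S ≤ cliqueSum y S + l * (y - x)
        lipschitz S {x} {y} b≤x x≤y y≤0 =
            ∣p-q∣≤⇒p≤ (subst (λ d → ∣ cliqueSum y S - cliqueSum x S ∣ ≤ l * d)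
              (ℚ.0≤p⇒∣p∣≡p (0≤difference x≤y)) (proj₂ (proj₂ lip) S ∣y∣≤ ∣x∣≤))
          , ∣p-q∣≤⇒p≤ (subst (λ d → ∣ cliqueSum x S - cliqueSum y S ∣ ≤ l * d)
              (trans (trans (sym (ℚ.∣-p∣≡∣p∣ (x - y)))
                (cong ∣_∣ (solve 2 (λ x y → :- (x :- y) := y :- x) refl x y)))
                (ℚ.0≤p⇒∣p∣≡p (0≤difference x≤y))) (proj₂ (proj₂ lip) S ∣x∣≤ ∣y∣≤))
          where
          ∣x∣≤ = ∣∣≤ b≤x (ℚ.≤-trans x≤y y≤0)
          ∣y∣≤ = ∣∣≤ (ℚ.≤-trans b≤x x≤y) y≤0

        -- Some S ⊆ B is nonpositive at lo n, and B has the least value at hi n.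
        value-hi : ∀ n → cliqueSum (hi n) B ≤ l * (hi n - lo n)
        value-hi n with S , S⊆B , S≤0 ← ¬allPositive (I.¬P-lo n) = begin
          cliqueSum (hi n) B
            ≤⟨ W-antitone (hi≤0 n) (recurrence (hi n)) (I.P-hi n) ⊆-refl S⊆B ⟩
          cliqueSum (hi n) S
            ≤⟨ proj₁ (lipschitz S {lo n} {hi n} (b≤lo n) (I.lo≤hi n) (hi≤0 n)) ⟩
          cliqueSum (lo n) S + l * (hi n - lo n)
            ≤⟨ ℚ.+-monoˡ-≤ (l * (hi n - lo n)) S≤0 ⟩
          0ℚ + l * (hi n - lo n)
            ≡⟨ ℚ.+-identityˡ (l * (hi n - lo n)) ⟩
          l * (hi n - lo n) ∎
          where open ℚ.≤-Reasoning

        -- The value at 0 is 1. If `hi n` were within `½ ^ k` of 0 for large `n`, the Lipschitz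
        -- bound and `value-hi` would make that value less than `h + h`, which is 1.
        root<0-from : ∀ {h} → h + h ≡ 1ℚ → (∃ λ k → ½ ^ k * l < h) →
          (∃ λ M → ∀ {n} → M ℕ.≤ n → l * (hi n - lo n) < h) → I.limit <ʳ 0ʳ
        root<0-from {h} h+h≡1 (k , small) (M , value) =
          ½ ^ k , ½^-pos k , M , λ {n} M≤n → ℚ.≮⇒≥ λ near → ℚ.<-irrefl refl (begin-strict
            1ℚ
              ≡⟨ W-at-0 (recurrence 0ℚ) B ⟨
            cliqueSum 0ℚ B
              ≤⟨ proj₁ (lipschitz B {hi n} {0ℚ} (b≤hi n) (hi≤0 n) ℚ.≤-refl) ⟩
            cliqueSum (hi n) B + l * (0ℚ - hi n)
              ≤⟨ ℚ.+-mono-≤ (value-hi n) (*-monoʳ-≤ l≥0 (ℚ.<⇒≤ (0-hi< {hi n} near))) ⟩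
            l * (hi n - lo n) + l * ½ ^ k
              <⟨ ℚ.+-mono-< (value M≤n) (subst (_< h) (ℚ.*-comm (½ ^ k) l) small) ⟩
            h + h
              ≡⟨ h+h≡1 ⟩
            1ℚ ∎)
          where
          open ℚ.≤-Reasoning
          0-hi< : ∀ {h ε} → 0ℚ < h + ε → 0ℚ - h < ε
          0-hi< {h} {ε} 0<h+ε = subst (0ℚ - h <_)
            (solve 2 (λ h e → (h :+ e) :- h := e) refl h ε) (ℚ.+-monoˡ-< (- h) 0<h+ε)

        root<0 : I.limit <ʳ 0ʳ
        root<0 = root<0-from {½} refl
          (½^*-vanishes l (ℚ.positive⁻¹ ½)) (I.width-vanishes l≥0 (ℚ.positive⁻¹ ½))

        ∣cliquePoly-hi∣ : ∀ n → ∣ seq (cliquePoly G B I.limit) n - 0ℚ ∣ ≡ cliqueSum (hi n) B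
        ∣cliquePoly-hi∣ n = begin
          ∣ seq (cliquePoly G B I.limit) n - 0ℚ ∣
            ≡⟨ cong (λ q → ∣ q - 0ℚ ∣) (seq-cliquePoly B I.limit n) ⟩
          ∣ cliqueSum (hi n) B - 0ℚ ∣
            ≡⟨ cong ∣_∣ (ℚ.+-identityʳ (cliqueSum (hi n) B)) ⟩
          ∣ cliqueSum (hi n) B ∣
            ≡⟨ ℚ.0≤p⇒∣p∣≡p (ℚ.<⇒≤ (I.P-hi n ⊆-refl)) ⟩
          cliqueSum (hi n) B ∎
          where open ≡-Reasoning

        root≈0 : cliquePoly G B I.limit ≈ʳ 0ʳ
        root≈0 ε ε>0 = proj₁ vanish , λ {n} M≤n → subst (_< ε) (sym (∣cliquePoly-hi∣ n))
          (ℚ.≤-<-trans (value-hi n) (proj₂ vanish M≤n))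
          where
          vanish = I.width-vanishes l≥0 ε>0

      root-above : ∃ λ y → NegRoot G B y × (∀ n → b ≤ seq y n)
      root-above = I.limit , (root<0 , root≈0) , b≤hi

-- Images under a section

module Section {m n} (f : Fin n → Fin m) (σ : Fin m → Fin n) (f∘σ : ∀ w → f (σ w) ≡ w) where

  private
    -- Since `f` inverts `σ`, a point `g` can only be the image of `f g`; membership is tested
    -- without searching `T`.
    InImage : Subset m → Pred (Fin n) _
    InImage T g = σ (f g) ≡ g × f g ∈ T

    inImage? : ∀ T → Decidable (InImage T)
    inImage? T g = (σ (f g) Fin.≟ g) ×-dec (f g ∈? T)

  image : Subset m → Subset n
  image T = subset (inImage? T)

  ∈-image⁺ : ∀ {T w} → w ∈ T → σ w ∈ image T
  ∈-image⁺ {T} {w} w∈T = ∈-subset⁺ (inImage? T)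
    (cong σ (f∘σ w) , subst (_∈ T) (sym (f∘σ w)) w∈T)

  ∈-image⁻ : ∀ {T g} → g ∈ image T → ∃ λ w → w ∈ T × σ w ≡ g
  ∈-image⁻ {T} {g} g∈ with σfg≡g , fg∈T ← ∈-subset⁻ (inImage? T) g∈ = f g , fg∈T , σfg≡g

  σ-injective : ∀ {u w} → σ u ≡ σ w → u ≡ w
  σ-injective {u} {w} eq = trans (sym (f∘σ u)) (trans (cong f eq) (f∘σ w))

  image-⊥ : image ⊥ ≡ ⊥
  image-⊥ = ⊆-antisym (λ g∈ → contradiction (proj₁ (proj₂ (∈-image⁻ g∈))) ∉⊥) (⊆-min _)

  image-∖ : ∀ T w → image (T ∖ w) ≡ image T ∖ σ w
  image-∖ T w = ⊆-antisym to from
    where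
    to : image (T ∖ w) ⊆ image T ∖ σ w
    to g∈ with u , u∈ , refl ← ∈-image⁻ g∈ = x∈p∧x≢y⇒x∈p-y (∈-image⁺ (∖⊆ T w u∈))
      λ eq → ∉-∖ T w (subst (_∈ T ∖ w) (σ-injective eq) u∈)
    from : image T ∖ σ w ⊆ image (T ∖ w)
    from g∈ with u , u∈ , refl ← ∈-image⁻ (∖⊆ (image T) (σ w) g∈) = ∈-image⁺
      (x∈p∧x≢y⇒x∈p-y u∈ λ { refl → ∉-∖ (image T) (σ w) g∈ })

  -- The hypotheses say that `R` is the preimage of `S` under `σ`; they are applied to
  -- neighbourhoods.
  image-∩ : ∀ T {R S} → (∀ {u} → u ∈ R → σ u ∈ S) → (∀ {u} → σ u ∈ S → u ∈ R) →
    image (T ∩ R) ≡ image T ∩ S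
  image-∩ T {R} {S} R⇒S S⇒R = ⊆-antisym to from
    where
    to : image (T ∩ R) ⊆ image T ∩ S
    to g∈ with u , u∈ , refl ← ∈-image⁻ g∈ =
      x∈p∩q⁺ (∈-image⁺ (p∩q⊆p T R u∈) , R⇒S (p∩q⊆q T R u∈))
    from : image T ∩ S ⊆ image (T ∩ R)
    from g∈ with u , u∈ , refl ← ∈-image⁻ (p∩q⊆p (image T) S g∈) =
      ∈-image⁺ (x∈p∩q⁺ (u∈ , S⇒R (p∩q⊆q (image T) S g∈)))

-- Comparison along a homomorphism

module _ (G H : Graph) {B-G : Subset (Graph.order G)} {B-H : Subset (Graph.order H)}
  {f : Graph.Vertex G → Graph.Vertex H}
  (hom : IsRelHomomorphism (Graph._~_ G) (Graph._~_ H) f)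
  (surjective : Surjective _≡_ _≡_ f) (onto : MapsOnto f B-G B-H) where

  private
    module G = Graph G
    module H = Graph H
    module CG = Roots G
    module CH = Roots H

    -- Over `B-H` the preimage comes from `onto`, elsewhere from surjectivity.
    section-in-B : ∀ w → ∃ λ v → f v ≡ w × (w ∈ B-H → v ∈ B-G)
    section-in-B w with w ∈? B-H
    ... | yes w∈ with v , v∈ , fv≡w ← Equivalence.to (onto w) w∈ = v , fv≡w , λ _ → v∈
    ... | no  w∉ = proj₁ (surjective w) , proj₂ (surjective w) refl , λ w∈ → contradiction w∈ w∉

    σ : H.Vertex → G.Vertex
    σ w = proj₁ (section-in-B w)

    f∘σ : ∀ w → f (σ w) ≡ w
    f∘σ w = proj₁ (proj₂ (section-in-B w))

    open Section f σ f∘σ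

    image⊆B : ∀ {T} → T ⊆ B-H → image T ⊆ B-G
    image⊆B T⊆ g∈ with w , w∈ , refl ← ∈-image⁻ g∈ = proj₂ (proj₂ (section-in-B w)) (T⊆ w∈)

    N-σ : H.Vertex → Subset H.order
    N-σ w = subset (λ u → σ w G.~? σ u)

    recurrence-σ : ∀ x → CliqueRecurrence x N-σ (CG.cliqueSum x ∘ image)
    recurrence-σ x = record
      { v∉N      = λ w w∈ → G.irrefl refl (∈-subset⁻ (λ u → σ w G.~? σ u) w∈)
      ; W-⊥      = trans (cong (CG.cliqueSum x) (image-⊥)) (CG.cliqueSum-⊥ x)
      ; W-remove = λ {T} {w} w∈T → trans (CG.cliqueSum-remove x (∈-image⁺ w∈T))
          (sym (cong₂ (λ S R → CG.cliqueSum x S + x * CG.cliqueSum x R)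
            (image-∖ T w)
            (image-∩ T
              (∈-subset⁺ (σ w G.~?_) ∘ ∈-subset⁻ (λ u → σ w G.~? σ u))
              (∈-subset⁺ (λ u → σ w G.~? σ u) ∘ ∈-subset⁻ (σ w G.~?_)))))
      }

    -- The homomorphism `f` sends an edge between `σ w` and `σ u` to one between `w` and `u`. The
    -- converse may fail, hence only an inclusion.
    N-σ⊆N : ∀ w → N-σ w ⊆ CH.N w
    N-σ⊆N w {u} u∈ = ∈-subset⁺ (w H.~?_) (subst₂ H._~_ (f∘σ w) (f∘σ u)
      (IsRelHomomorphism.cong hom (∈-subset⁻ (λ u → σ w G.~? σ u) u∈)))

  -- First discard the vertices of `B-G` outside the image of the section, then pass to the possibly
  -- larger edge set of `H`.
  cliqueSum-comparison : ∀ {x} → x ≤ 0ℚ → CG.AllPositive B-G x →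
    CG.cliqueSum x B-G ≤ CH.cliqueSum x B-H
  cliqueSum-comparison {x} x≤0 pos = ℚ.≤-trans
    (W-antitone x≤0 (CG.recurrence x) pos ⊆-refl (image⊆B ⊆-refl))
    (W-comparison x≤0 (recurrence-σ x) (CH.recurrence x) N-σ⊆N (λ T⊆ → pos (image⊆B T⊆)) ⊆-refl)

  -- Transfer of roots from `H` to `G`

  private
    module _ {x : ℝ} {N₀ : ℕ} (x≤0 : ∀ {n} → N₀ ℕ.≤ n → seq x n ≤ 0ℚ)
      (pos : ∀ {n} → N₀ ℕ.≤ n → CG.AllPositive B-G (seq x n)) where

      ∣cliquePoly∣≤ : ∀ {n} → N₀ ℕ.≤ n →
        ∣ seq (cliquePoly G B-G x) n - 0ℚ ∣ ≤ ∣ seq (cliquePoly H B-H x) n - 0ℚ ∣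
      ∣cliquePoly∣≤ {n} N₀≤n = begin
        ∣ seq (cliquePoly G B-G x) n - 0ℚ ∣
          ≡⟨ cong ∣_∣ (trans (ℚ.+-identityʳ (seq (cliquePoly G B-G x) n)) (CG.seq-cliquePoly B-G x n)) ⟩
        ∣ CG.cliqueSum (seq x n) B-G ∣
          ≡⟨ ℚ.0≤p⇒∣p∣≡p (ℚ.<⇒≤ (pos N₀≤n ⊆-refl)) ⟩
        CG.cliqueSum (seq x n) B-G
          ≤⟨ cliqueSum-comparison (x≤0 N₀≤n) (pos N₀≤n) ⟩
        CH.cliqueSum (seq x n) B-H
          ≤⟨ p≤∣p∣ (CH.cliqueSum (seq x n) B-H) ⟩
        ∣ CH.cliqueSum (seq x n) B-H ∣
          ≡⟨ cong ∣_∣ (trans (ℚ.+-identityʳ (seq (cliquePoly H B-H x) n)) (CH.seq-cliquePoly B-H x n)) ⟨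
        ∣ seq (cliquePoly H B-H x) n - 0ℚ ∣ ∎
        where open ℚ.≤-Reasoning

      -- The values for `G` are positive and bounded by those for `H`, which tend to 0.
      root-transfers : cliquePoly H B-H x ≈ʳ 0ʳ → cliquePoly G B-G x ≈ʳ 0ʳ
      root-transfers root ε ε>0 with M , small ← root ε ε>0
        = M ℕ.⊔ N₀ , λ {n} h → ℚ.≤-<-trans
          (∣cliquePoly∣≤ (ℕ.m⊔n≤o⇒n≤o M N₀ h)) (small (ℕ.m⊔n≤o⇒m≤o M N₀ h))

  -- If a member x n of the sequence (n large) lies outside the positivity
  -- region of G, a root is found by bisection in [x n , 0]; otherwise x itself
  -- is a root. Which case holds is not decidable, hence the double negation.
  ¬¬root-near : ∀ {x} → NegRoot H B-H x → ∀ {ε} → 0ℚ < ε →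
    ¬ ¬ ∃ λ y → NegRoot G B-G y × ∃ λ M → ∀ {n} → M ℕ.≤ n → seq x n ≤ seq y n + ε
  ¬¬root-near {x} (x<0@(δ , δ>0 , M , x+δ≤0) , root) {ε} ε>0 ¬root =
    ¬root (x , (x<0 , root-transfers {x} {N₀} x≤0 pos root) , 0 , λ {n} _ → x≤x+ε n)
    where
    close = cauchy x ε ε>0
    M′ = proj₁ close
    N₀ = M ℕ.⊔ M′

    x≤x+ε : ∀ n → seq x n ≤ seq x n + ε
    x≤x+ε n = ≤-by-difference refl (ℚ.<⇒≤ ε>0)

    x≤0 : ∀ {n} → N₀ ℕ.≤ n → seq x n ≤ 0ℚ
    x≤0 {n} N₀≤n = ℚ.≤-trans (≤-by-difference refl (ℚ.<⇒≤ δ>0)) (x+δ≤0 (ℕ.m⊔n≤o⇒m≤o M M′ N₀≤n))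

    -- A bad term `seq x n` would give a root `y` with terms above it, hence above `seq x k - ε` for
    -- large `k`, against `¬root`.
    pos : ∀ {n} → N₀ ℕ.≤ n → CG.AllPositive B-G (seq x n)
    pos {n} N₀≤n = decidable-stable (CG.allPositive? B-G (seq x n)) λ ¬pos →
      let y , root-y , above = CG.root-above B-G (x≤0 N₀≤n) ¬pos
      in ¬root (y , root-y , M′ , λ {k} M′≤k → ℚ.≤-trans
           (∣p-q∣≤⇒p≤ (ℚ.<⇒≤ (proj₂ close M′≤k (ℕ.m⊔n≤o⇒n≤o M M′ N₀≤n))))
           (ℚ.+-monoˡ-≤ ε (above k)))

corollary4p4 : ∀ (G H : Graph)
    (B-G : Subset (Graph.order G)) (B-H : Subset (Graph.order H))
    (ζ-G ζ-H : ℝ ₋) →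
    IsZeta G B-G ζ-G → IsZeta H B-H ζ-H →
    ζ-G <₋∞ ζ-H →
    ¬ (∃ λ (f : Graph.Vertex G → Graph.Vertex H) →
    IsRelHomomorphism (Graph._~_ G) (Graph._~_ H) f ×
    Surjective _≡_ _≡_ f ×
    MapsOnto f B-G B-H)
-- Here `G` has no negative root at all, so any positive distance serves. The goal is a negation, so
-- the double negation is harmless.
corollary4p4 G H _ _ ⊥₋ _ (noRoot none) (largest root-x _) _ (f , hom , surj , onto) =
  ¬¬root-near G H hom surj onto root-x (ℚ.positive⁻¹ 1ℚ) λ (y , root-y , _) → none y root-y
corollary4p4 G H _ _ [ z ] [ x ] (largest _ z-max) (largest root-x _)
  AddInfimum.[ ε , ε>0 , M , z+ε≤x ] (f , hom , surj , onto) =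
  -- Half of the gap `ε` is spent on approximating `x`; the other half keeps `y` strictly above `z`.
  ¬¬root-near G H hom surj onto root-x (½*-pos ε>0) λ (y , root-y , M′ , x≤y+½ε) →
    z-max y root-y (½ * ε , ½*-pos ε>0 , M ℕ.⊔ M′ , λ {n} h →
      cancel (seq z n) (ℚ.≤-trans (z+ε≤x (ℕ.m⊔n≤o⇒m≤o M M′ h)) (x≤y+½ε (ℕ.m⊔n≤o⇒n≤o M M′ h))))
  where
  cancel : ∀ z {y} → z + ε ≤ y + ½ * ε → z + ½ * ε ≤ y
  cancel z {y} h = subst₂ _≤_
    (solve 2 (λ z e → (z :+ e) :- con ½ :* e := z :+ con ½ :* e) refl z ε)
    (solve 2 (λ y e → (y :+ con ½ :* e) :- con ½ :* e := y) refl y ε)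
    (ℚ.+-monoˡ-≤ (- (½ * ε)) h)
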